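{- If $(G,\gamma)$ is an edge-colored graph with $\ell\geq 2$ colors $c_1,\dots,c_\ell$, then \[\operatorname{wld}(G)\geq\left\lceil \frac{\sum_{i=1}^{\ell}(\kappa(G_i)-1)}{\ell-1}\right\rceil.\]
   Context: An edge-colored graph $(G,\gamma)$ is a finite connected graph $G$ with a surjective function $\gamma:E(G)\to\mathcal{C}=\{c_1,\dots,c_\ell\}$ onto a finite set of colors (not necessarily a proper edge-coloring). For each color $c_i$ let $E_i(G)=\{e\in E(G):\gamma(e)=c_i\}$ and let $G_i$ be the graph with vertex set $V(G)$ and edge set $E_i(G)$; $\kappa(G_i)$ is its number of connected components. For $W\subseteq E(G)$, let $G_i^W$ be the graph with vertex set $V(G)$ and edge set $W\cup E_i(G)$. The set $W$ is color-connecting if $G_i^W$ is connected for every color $c_i\in\mathcal{C}$. The wild number $\operatorname{wld}(G)$ is the minimum size of a color-connecting set. -}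

module Defs where

open import Data.Bool using (if_then_else_)
open import Data.Empty using (⊥-elim)
open import Data.Fin using (Fin; _≟_)
open import Data.Fin.Properties using (all?)
open import Data.Fin.Subset using (Subset; _∈_; _∪_; ⊤; ∣_∣)
open import Data.Fin.Subset.Properties using (_∈?_; p⊆p∪q; ∈⊤; anySubset?)
open import Data.List using (List; []; _∷_; allFin; filter; deduplicate; length)
open import Data.List.Membership.Propositional as List using ()
open import Data.List.Membership.Propositional.Properties
  using (∈-filter⁺; ∈-filter⁻; ∈-allFin)
open import Data.List.Relation.Unary.Any using (here; there)
open import Data.Nat using (ℕ; _≤_; _<_; _<?_; _∸_; NonZero; >-nonZero)
open import Data.Nat.Induction using (<-wellFounded; Acc; acc)
open import Data.Nat.Properties using (m<n⇒0<n∸m; ≮⇒≥)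
open import Data.Product using (∃; _×_; _,_; proj₁; proj₂; map₂)
open import Data.Vec using (tabulate)
open import Function using (_∘_)
open import Function.Definitions using (Surjective)
open import Level using (0ℓ)
open import Relation.Binary.Construct.Closure.Equivalence as Eq using (EqClosure)
open import Relation.Binary.Construct.Closure.ReflexiveTransitive using (ε; _◅_)
open import Relation.Binary.Construct.Closure.Symmetric using (fwd)
open import Relation.Binary.Core using (Rel)
open import Relation.Binary.Definitions using (Decidable)
open import Relation.Binary.PropositionalEquality
  using (_≡_; refl; sym; trans; cong; isEquivalence)
open import Relation.Nullary using (yes; no; does)
open import Relation.Nullary.Decidable using (map′; _×-dec_)
import Relation.Unary as U

-- A finite undirected graph.  An edge is stored as a pair of end-points in an
-- arbitrary order; loops and parallel edges are permitted, simple graphs being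
-- a special case.
record Graph : Set where
  field
    #V   : ℕ
    #E   : ℕ
    ends : Fin #E → Fin #V × Fin #V

  Vertex Edge : Set
  Vertex = Fin #V
  Edge   = Fin #E

-- A set S of edges stands for the spanning subgraph (V(G) , S).
module SpanningSubgraph (G : Graph) where
  open Graph G

  Joins : Subset #E → Rel Vertex 0ℓ
  Joins S u v = ∃ λ e → e ∈ S × ends e ≡ (u , v)

  -- A walk in (V(G) , S); its edges may be traversed in either direction.
  Walk : Subset #E → Rel Vertex 0ℓ
  Walk S = EqClosure (Joins S)

  -- Connected graphs are nonempty.
  Connected : Subset #E → Set
  Connected S = Vertex × (∀ u v → Walk S u v)

  private
    JoinsL : List Edge → Rel Vertex 0ℓ
    JoinsL es u v = ∃ λ e → e List.∈ es × ends e ≡ (u , v)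

    merge : Vertex → Vertex → Vertex → Vertex
    merge a b x = if does (x ≟ b) then a else x

    merge-b : ∀ a b → merge a b a ≡ merge a b b
    merge-b a b with a ≟ b | b ≟ b
    ... | yes _ | yes _ = refl
    ... | no  _ | yes _ = refl
    ... | _     | no ¬p = ⊥-elim (¬p refl)

    -- Two vertices get the same label iff they are joined by a walk.
    label : List Edge → Vertex → Vertex
    label []       v = v
    label (e ∷ es) v =
      merge (label es (proj₁ (ends e))) (label es (proj₂ (ends e))) (label es v)

    label-edge : ∀ es {u v} → JoinsL es u v → label es u ≡ label es v
    label-edge (e ∷ es) (.e , here refl , eq) rewrite eq =
      merge-b (label es _) (label es _)
    label-edge (e ∷ es) (f , there f∈ , eq) =
      cong (merge (label es (proj₁ (ends e))) (label es (proj₂ (ends e))))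
           (label-edge es (f , f∈ , eq))

    label-complete : ∀ es {u v} → EqClosure (JoinsL es) u v → label es u ≡ label es v
    label-complete es = Eq.gfold isEquivalence (label es) (label-edge es)

    weaken : ∀ {e es u v} → EqClosure (JoinsL es) u v → EqClosure (JoinsL (e ∷ es)) u v
    weaken = Eq.map (map₂ λ (f∈ , r) → there f∈ , r)

    label-sound : ∀ es u v → label es u ≡ label es v → EqClosure (JoinsL es) u v
    label-sound []       u .u refl = ε
    label-sound (e ∷ es) u v eq
      with label es u ≟ label es (proj₂ (ends e))
         | label es v ≟ label es (proj₂ (ends e))
    ... | yes p | yes q = weaken (label-sound es u v (trans p (sym q)))
    ... | no _  | no _  = weaken (label-sound es u v eq)
    ... | yes p | no _  =
      Eq.transitive _ (weaken (label-sound es u _ p))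
        (Eq.transitive _ (Eq.symmetric _ (fwd (e , here refl , refl) ◅ ε))
          (weaken (label-sound es _ v eq)))
    ... | no _  | yes q =
      Eq.transitive _ (weaken (label-sound es u _ eq))
        (fwd (e , here refl , refl) ◅ weaken (label-sound es _ v (sym q)))

  walk? : ∀ S → Decidable (Walk S)
  walk? S u v = map′
    (Eq.map (map₂ λ (e∈ , r) → proj₂ (∈-filter⁻ (_∈? S) {xs = allFin #E} e∈) , r) ∘ label-sound es u v)
    (label-complete es ∘ Eq.map (map₂ λ (e∈ , r) → ∈-filter⁺ (_∈? S) (∈-allFin _) e∈ , r))
    (label es u ≟ label es v)
    where es = filter (_∈? S) (allFin #E)

  -- The number of connected components of (V(G) , S): the deduplicated list
  -- has exactly one vertex from each component.
  κ : Subset #E → ℕ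
  κ S = length (deduplicate (walk? S) (allFin #V))

  connected? : U.Decidable (λ S → ∀ u v → Walk S u v)
  connected? S = all? λ u → all? λ v → walk? S u v

record EdgeColoredGraph (ℓ : ℕ) : Set where
  field
    graph : Graph
  open Graph graph public
  open SpanningSubgraph graph public
  field
    connected  : Connected ⊤
    γ          : Edge → Fin ℓ
    surjective : Surjective _≡_ _≡_ γ

  -- E i also stands for the graph Gᵢ.
  E : Fin ℓ → Subset #E
  E i = tabulate λ e → does (γ e ≟ i)

  ColorConnecting : Subset #E → Set
  ColorConnecting W = ∀ i → Connected (W ∪ E i)

  IsMinimumSize : ℕ → Set
  IsMinimumSize w = (∃ λ W → ColorConnecting W × ∣ W ∣ ≡ w)
                  × (∀ W → ColorConnecting W → w ≤ ∣ W ∣)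

  private
    colorConnecting? : U.Decidable ColorConnecting
    colorConnecting? W = all? λ i →
      map′ (proj₁ connected ,_) proj₂ (connected? (W ∪ E i))

    ⊤-colorConnecting : ColorConnecting ⊤
    ⊤-colorConnecting i = proj₁ connected , λ u v →
      Eq.map (map₂ λ (e∈ , r) → p⊆p∪q (E i) e∈ , r) (proj₂ connected u v)

    descend : ∀ W → Acc _<_ ∣ W ∣ → ColorConnecting W → ∃ IsMinimumSize
    descend W (acc rec) cc
      with anySubset? (λ U → colorConnecting? U ×-dec (∣ U ∣ <? ∣ W ∣))
    ... | yes (U , ccU , U<W) = descend U (rec U<W) ccU
    ... | no ¬smaller = ∣ W ∣ , (W , cc , refl) ,
      λ U ccU → ≮⇒≥ λ U<W → ¬smaller (U , ccU , U<W)

  minimumSize : ∃ IsMinimumSize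
  minimumSize = descend ⊤ (<-wellFounded _) ⊤-colorConnecting

  wld : ℕ
  wld = proj₁ minimumSize

n∸1-nonZero : ∀ {n} → 2 ≤ n → NonZero (n ∸ 1)
n∸1-nonZero 2≤n = >-nonZero (m<n⇒0<n∸m 2≤n)

{-# OPTIONS --safe #-}
-- Contracting one edge lowers the number of components by at most one, and the
-- edges of W of color i are contracted in Gᵢ already.  Hence κ(Gᵢ) - 1 is at
-- most the number of edges of W of a color other than i.  Each edge of W is
-- counted by all ℓ - 1 colors that it does not have, so summing over i gives
-- Σᵢ (κ(Gᵢ) - 1) ≤ (ℓ - 1) |W|.
module Submission where

open import Defs
open import Data.Nat using (ℕ; _∸_) renaming (_≤_ to _≤ℕ_)
open import Data.Integer using (ℤ; +_; _-_; _≤_; 1ℤ)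
open import Data.Integer.Properties using (+-0-commutativeMonoid)
open import Data.Rational using (_/_; ceiling)
open import Algebra.Properties.CommutativeMonoid.Sum +-0-commutativeMonoid using (sum)

open import Algebra.Properties.CommutativeMonoid.Sum +-0-commutativeMonoid
  using (sum-remove; sum-cong-≗; sum-replicate-zero; ∑-distrib-+)
open import Data.Bool using (true; false)
open import Data.Empty using (⊥-elim)
open import Data.Fin using (Fin; zero; suc; punchIn; _≟_)
open import Data.Fin.Properties using (punchInᵢ≢i)
open import Data.Fin.Subset using (Subset; _∈_; _∪_; ∣_∣)
open import Data.Fin.Subset.Properties using (x∈p∪q⁻)
import Data.Integer as ℤ
import Data.Integer.DivMod as ℤ
import Data.Integer.GCD as ℤ
import Data.Integer.Properties as ℤ
open import Data.List using (List; []; _∷_; [_]; length; map; filter; allFin)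
import Data.List.Membership.Propositional as List
open import Data.List.Membership.Propositional.Properties using (∈-map⁺; ∈-filter⁺)
open import Data.List.Properties
  using (length-map; length-++; filter-++; filter-accept; filter-reject; filter-all)
open import Data.List.Relation.Unary.All as All using (All; []; _∷_)
open import Data.List.Relation.Unary.All.Properties using (all-filter)
open import Data.List.Relation.Unary.AllPairs using (AllPairs; []; _∷_)
import Data.List.Relation.Unary.AllPairs.Properties as AllPairs
open import Data.List.Relation.Unary.Any using (here; there)
import Data.List.Relation.Unary.Unique.DecSetoid.Properties as Unique
import Data.Nat as ℕ
import Data.Nat.GCD as ℕ
import Data.Nat.Properties as ℕ
open import Data.Product using (_,_; proj₂)
open import Data.Rational using (floor; -_; ↥_; ↧_; ↧ₙ_)
import Data.Rational.Properties as ℚ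
open import Data.Sum using (_⊎_; inj₁; inj₂)
open import Data.Vec using ([]; _∷_; here; there)
open import Data.Vec.Properties using (lookup⇒[]=; lookup∘tabulate)
open import Function using (_∘_)
open import Level using (0ℓ)
open import Relation.Binary.Bundles using (DecSetoid)
open import Relation.Binary.Construct.Closure.Equivalence as Eq using (EqClosure)
import Relation.Binary.Construct.On as On
open import Relation.Binary.Construct.Closure.ReflexiveTransitive using (ε; _◅_)
open import Relation.Binary.Construct.Closure.Symmetric using (fwd)
open import Relation.Binary.PropositionalEquality
  using (_≡_; refl; sym; trans; cong; cong₂; subst; subst₂; ≢-sym; module ≡-Reasoning)
open import Relation.Nullary using (¬_; Dec; yes; no)
open import Relation.Nullary.Decidable using (¬?; dec-true)

-- Ceilings of fractions.

≤-floor : ∀ p {k} → k ℤ.* ↧ p ≤ ↥ p → k ≤ floor p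
-- Matching on `record{}` lets `floor p` unfold to integer division.
≤-floor p@record{} {k} k≤p = subst (k ≤_) (ℤ.pred-suc (floor p)) (ℤ.i<j⇒i≤pred[j] k<1+⌊p⌋)
  where
  open ℤ.≤-Reasoning
  k<1+⌊p⌋ : k ℤ.< ℤ.suc (floor p)
  k<1+⌊p⌋ = ℤ.*-cancelʳ-<-nonNeg (↧ p) (begin-strict
    k ℤ.* ↧ p                        ≤⟨ k≤p ⟩
    ↥ p                              <⟨ ℤ.n<s[n/ℕd]*d (↥ p) (↧ₙ p) ⟩
    ℤ.suc (↥ p ℤ./ℕ ↧ₙ p) ℤ.* ↧ p    ≡⟨ cong (λ q → ℤ.suc q ℤ.* ↧ p)
                                          (ℤ.div-pos-is-/ℕ (↥ p) (↧ₙ p)) ⟨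
    ℤ.suc (floor p) ℤ.* ↧ p          ∎)

-- `ceiling p` unfolds to minus the floor of `- p`, so this is `≤-floor` at `- p` and `- k`.
ceiling-≤ : ∀ p {k} → ↥ p ≤ k ℤ.* ↧ p → ceiling p ≤ k
ceiling-≤ p@record{} {k} p≤k =
  subst (ceiling p ≤_) (ℤ.neg-involutive k) (ℤ.neg-mono-≤ (≤-floor (- p) (begin
    ℤ.- k ℤ.* ↧ (- p)  ≡⟨ cong (ℤ.- k ℤ.*_) (ℚ.↧-neg p) ⟩
    ℤ.- k ℤ.* ↧ p      ≡⟨ ℤ.neg-distribˡ-* k (↧ p) ⟨
    ℤ.- (k ℤ.* ↧ p)    ≤⟨ ℤ.neg-mono-≤ p≤k ⟩
    ℤ.- ↥ p            ≡⟨ ℚ.↥-neg p ⟨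
    ↥ (- p)            ∎)))
  where open ℤ.≤-Reasoning

-- The fraction `i / n` is stored in lowest terms, so its numerator and denominator become `i` and
-- `n` only after multiplication by their gcd, which is positive since `n` is nonzero and hence can
-- be cancelled.
i≤k*n⇒⌈i/n⌉≤k : ∀ i n .{{_ : ℕ.NonZero n}} {k} → i ≤ k ℤ.* + n → ceiling (i / n) ≤ k
i≤k*n⇒⌈i/n⌉≤k i n {k} i≤kn = ceiling-≤ (i / n) (ℤ.*-cancelʳ-≤-pos _ _ (ℤ.gcd i (+ n)) (begin
  ↥ (i / n) ℤ.* g          ≡⟨ ℚ.↥-/ i n ⟩
  i                        ≤⟨ i≤kn ⟩
  k ℤ.* + n                ≡⟨ cong (k ℤ.*_) (ℚ.↧-/ i n) ⟨
  k ℤ.* (↧ (i / n) ℤ.* g)  ≡⟨ ℤ.*-assoc k (↧ (i / n)) g ⟨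
  k ℤ.* ↧ (i / n) ℤ.* g    ∎))
  where
  open ℤ.≤-Reasoning
  g = ℤ.gcd i (+ n)
  instance
    g-pos : ℤ.Positive g
    g-pos = ℤ.positive (ℤ.+<+ (ℕ.n≢0⇒n>0
      (ℕ.gcd[m,n]≢0 ℤ.∣ i ∣ n (inj₂ (ℕ.≢-nonZero⁻¹ n)))))

-- Counting edges by the colors that they avoid.

sum-mono-≤ : ∀ {n} {f g : Fin n → ℤ} → (∀ i → f i ≤ g i) → sum f ≤ sum g
sum-mono-≤ {ℕ.zero}  f≤g = ℤ.≤-refl
sum-mono-≤ {ℕ.suc n} f≤g = ℤ.+-mono-≤ (f≤g zero) (sum-mono-≤ (f≤g ∘ suc))

length-filter-∷ : ∀ {A : Set} {P : A → Set} (P? : ∀ x → Dec (P x)) x xs →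
  length (filter P? (x ∷ xs)) ≡ length (filter P? [ x ]) ℕ.+ length (filter P? xs)
length-filter-∷ P? x xs =
  trans (cong length (filter-++ P? [ x ] xs)) (length-++ (filter P? [ x ]))

module _ {A : Set} {m} (c : A → Fin (ℕ.suc m)) where

  avoiding : Fin (ℕ.suc m) → List A → List A
  avoiding i = filter λ x → ¬? (c x ≟ i)

  private
    count : List A → Fin (ℕ.suc m) → ℤ
    count xs i = + length (avoiding i xs)

  -- The color of `x` itself contributes 0. The other `m` colors, enumerated by `punchIn (c x)`,
  -- contribute 1 each.
  sum-avoiding-[x] : ∀ x → sum (count [ x ]) ≡ + m
  sum-avoiding-[x] x = begin
    sum (count [ x ])                                 ≡⟨ sum-remove {i = c x} (count [ x ]) ⟩
    count [ x ] (c x) ℤ.+ sum (λ j → count [ x ] (punchIn (c x) j))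
      ≡⟨ cong₂ ℤ._+_
           (cong (+_ ∘ length) (filter-reject (λ y → ¬? (c y ≟ c x)) λ cx≢cx → cx≢cx refl))
           (sum-cong-≗ λ j → cong (+_ ∘ length)
             (filter-accept (λ y → ¬? (c y ≟ punchIn (c x) j)) (≢-sym (punchInᵢ≢i (c x) j)))) ⟩
    ℤ.0ℤ ℤ.+ sum {m} (λ _ → 1ℤ)                          ≡⟨ ℤ.+-identityˡ _ ⟩
    sum {m} (λ _ → 1ℤ)                                  ≡⟨ sum-1 m ⟩
    + m                                                ∎
    where
    open ≡-Reasoning
    sum-1 : ∀ n → sum {n} (λ _ → 1ℤ) ≡ + n
    sum-1 ℕ.zero    = refl
    sum-1 (ℕ.suc n) = cong ℤ.suc (sum-1 n)

  sum-avoiding : ∀ xs → sum (λ i → + length (avoiding i xs)) ≡ + (length xs ℕ.* m)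
  sum-avoiding []       = sum-replicate-zero (ℕ.suc m)
  sum-avoiding (x ∷ xs) = begin
    sum (count (x ∷ xs))
      ≡⟨ sum-cong-≗ (λ i → cong +_ (length-filter-∷ (λ y → ¬? (c y ≟ i)) x xs)) ⟩
    sum (λ i → count [ x ] i ℤ.+ count xs i)  ≡⟨ ∑-distrib-+ (count [ x ]) (count xs) ⟩
    sum (count [ x ]) ℤ.+ sum (count xs)      ≡⟨ cong₂ ℤ._+_ (sum-avoiding-[x] x) (sum-avoiding xs) ⟩
    + (m ℕ.+ length xs ℕ.* m)                 ∎
    where open ≡-Reasoning

-- Subsets as lists; pairwise relations.

elements : ∀ {n} → Subset n → List (Fin n)
elements []          = []
elements (true  ∷ p) = zero ∷ map suc (elements p)
elements (false ∷ p) = map suc (elements p)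

length-elements : ∀ {n} (p : Subset n) → length (elements p) ≡ ∣ p ∣
length-elements []          = refl
length-elements (true  ∷ p) = cong ℕ.suc (trans (length-map suc (elements p)) (length-elements p))
length-elements (false ∷ p) = trans (length-map suc (elements p)) (length-elements p)

∈-elements : ∀ {n} {p : Subset n} {x} → x ∈ p → x List.∈ elements p
∈-elements {p = true  ∷ p} here      = here refl
∈-elements {p = true  ∷ p} (there x) = there (∈-map⁺ suc (∈-elements x))
∈-elements {p = false ∷ p} (there x) = ∈-map⁺ suc (∈-elements x)

AllPairs-mapWithAll : ∀ {A : Set} {P : A → Set} {R T : A → A → Set} →
  (∀ {x y} → P x → P y → R x y → T x y) → ∀ {xs} → All P xs → AllPairs R xs → AllPairs T xs
AllPairs-mapWithAll f []         []         = []
AllPairs-mapWithAll f (px ∷ pxs) (rx ∷ rxs) =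
  All.zipWith (λ (py , rxy) → f px py rxy) (pxs , rx) ∷ AllPairs-mapWithAll f pxs rxs

-- Contracting a pair of points.

module Contraction (S : DecSetoid 0ℓ 0ℓ) where
  open DecSetoid S using (Carrier; _≈_; isDecEquivalence) renaming (_≟_ to _≈?_)
  module ≈ = DecSetoid S

  identify : Carrier → Carrier → Carrier → Carrier
  identify a b x with x ≈? b
  ... | yes _ = a
  ... | no  _ = x

  module _ {a b : Carrier} where

    identify-≈ : ∀ {x} → x ≈ b → identify a b x ≡ a
    identify-≈ {x} x≈b with x ≈? b
    ... | yes _  = refl
    ... | no x≉b = ⊥-elim (x≉b x≈b)

    identify-≉ : ∀ {x} → ¬ x ≈ b → identify a b x ≡ x
    identify-≉ {x} x≉b with x ≈? b
    ... | yes x≈b = ⊥-elim (x≉b x≈b)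
    ... | no _    = refl

    identify-cong : ∀ {x y} → x ≈ y → identify a b x ≈ identify a b y
    identify-cong {x} {y} x≈y with x ≈? b | y ≈? b
    ... | yes _   | yes _   = ≈.refl
    ... | no  _   | no  _   = x≈y
    ... | yes x≈b | no  y≉b = ⊥-elim (y≉b (≈.trans (≈.sym x≈y) x≈b))
    ... | no  x≉b | yes y≈b = ⊥-elim (x≉b (≈.trans x≈y y≈b))

    identify-ends : identify a b a ≈ identify a b b
    identify-ends rewrite identify-≈ {b} ≈.refl with a ≈? b
    ... | yes _ = ≈.refl
    ... | no  _ = ≈.refl

  -- Pulling `_≈_` back along `identify a b` merges the class of `b` into that of `a` and keeps all
  -- other classes. The carrier is unchanged, so pairs still to be contracted keep their meaning.
  contract : Carrier → Carrier → DecSetoid 0ℓ 0ℓ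
  contract a b = record
    { isDecEquivalence = On.isDecEquivalence (identify a b) isDecEquivalence }

  -- Among pairwise inequivalent entries at most one lies in the class of `b`.
  length-filter-≉ : ∀ b {xs} → AllPairs (λ x y → ¬ x ≈ y) xs →
    length xs ≤ℕ ℕ.suc (length (filter (λ x → ¬? (x ≈? b)) xs))
  length-filter-≉ b {[]}     []          = ℕ.z≤n
  length-filter-≉ b {x ∷ xs} (x≉ ∷ xs≉) with x ≈? b
  ... | no  _   = ℕ.s≤s (length-filter-≉ b xs≉)
  -- The one entry in the class of `b` is found, so the filter keeps the whole tail.
  ... | yes x≈b = ℕ.s≤s (ℕ.≤-reflexive (cong length (sym (filter-all (λ x → ¬? (x ≈? b))
    (All.map (λ x≉y y≈b → x≉y (≈.trans x≈b (≈.sym y≈b))) x≉)))))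

open Contraction

-- Induction on `es`, for all setoids at once because each step contracts the setoid. Contracting a
-- pair costs at most one entry of `xs`; with no pairs left, `_≈_` is total and two inequivalent
-- entries are impossible.
length≤1+identifications : ∀ (S : DecSetoid 0ℓ 0ℓ) → let open DecSetoid S in
  ∀ es {xs} → AllPairs (λ x y → ¬ x ≈ y) xs →
  (∀ x y → EqClosure (λ u v → u ≈ v ⊎ (u , v) List.∈ es) x y) →
  length xs ≤ℕ ℕ.suc (length es)
length≤1+identifications S [] {[]}        _ _ = ℕ.z≤n
length≤1+identifications S [] {_ ∷ []}    _ _ = ℕ.s≤s ℕ.z≤n
length≤1+identifications S [] {x ∷ y ∷ _} ((x≉y ∷ _) ∷ _) total =
  ⊥-elim (x≉y (Eq.fold isEquivalence (λ { (inj₁ p) → p }) (total x y)))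
  where open DecSetoid S
length≤1+identifications S ((a , b) ∷ es) {xs} xs≉ total =
  ℕ.≤-trans (length-filter-≉ S b xs≉) (ℕ.s≤s
    (length≤1+identifications (contract S a b) es {ys} ys≉
      λ x y → Eq.map (λ where
        (inj₁ x≈y)          → inj₁ (identify-cong S x≈y)
        -- The contracted pair has become an equivalence and can leave the list.
        (inj₂ (here refl))  → inj₁ (identify-ends S)
        (inj₂ (there xy∈es)) → inj₂ xy∈es) (total x y)))
  where
  open DecSetoid S using (_≈_) renaming (_≟_ to _≈?_)
  ≉b? = λ x → ¬? (x ≈? b)
  ys = filter ≉b? xs
  ys≉ : AllPairs (λ x y → ¬ identify S a b x ≈ identify S a b y) ys
  -- Outside the class of `b`, `identify` fixes every point, so entries stay inequivalent after the
  -- contraction.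
  ys≉ = AllPairs-mapWithAll
    (λ x≉b y≉b → subst₂ (λ x y → ¬ x ≈ y) (sym (identify-≉ S x≉b)) (sym (identify-≉ S y≉b)))
    (all-filter ≉b? xs) (AllPairs.filter⁺ ≉b? xs≉)

-- Application to the components of each color.

module _ {m} (G : EdgeColoredGraph (ℕ.suc m)) where
  open EdgeColoredGraph G

  ∈-E⁺ : ∀ {e i} → γ e ≡ i → e ∈ E i
  ∈-E⁺ {e} {i} γe≡i = lookup⇒[]= e (E i) (trans (lookup∘tabulate _ e) (dec-true (γ e ≟ i) γe≡i))

  walkDecSetoid : Subset #E → DecSetoid 0ℓ 0ℓ
  walkDecSetoid S = record
    { isDecEquivalence = record { isEquivalence = Eq.isEquivalence (Joins S) ; _≟_ = walk? S } }

  -- The classes of `walkDecSetoid (E i)` are the components of Gᵢ, and `κ` counts pairwise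
  -- inequivalent representatives. The edges of `W` of other colors serve as the identifications.
  κ≤1+avoiding : ∀ {W} → ColorConnecting W → ∀ i →
    κ (E i) ≤ℕ ℕ.suc (length (avoiding γ i (elements W)))
  κ≤1+avoiding {W} cc i = subst (λ n → κ (E i) ≤ℕ ℕ.suc n) (length-map ends es)
    (length≤1+identifications (walkDecSetoid (E i)) (map ends es)
      (Unique.deduplicate-! (walkDecSetoid (E i)) (allFin #V))
      λ u v → Eq.map step (proj₂ (cc i) u v))
    where
    es = avoiding γ i (elements W)
    step : ∀ {u v} → Joins (W ∪ E i) u v → Walk (E i) u v ⊎ (u , v) List.∈ map ends es
    -- The color is tested first: an edge of `W` of color `i` is already a walk in Gᵢ and must not
    -- be charged to `es`.
    step (e , e∈ , refl) with γ e ≟ i | x∈p∪q⁻ W (E i) e∈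
    ... | yes γe≡i | _           = inj₁ (fwd (e , ∈-E⁺ γe≡i , refl) ◅ ε)
    ... | no  _    | inj₂ e∈Eᵢ   = inj₁ (fwd (e , e∈Eᵢ , refl) ◅ ε)
    ... | no  γe≢i | inj₁ e∈W    =
      inj₂ (∈-map⁺ ends (∈-filter⁺ (λ x → ¬? (γ x ≟ i)) (∈-elements e∈W) γe≢i))

  κ-1≤avoiding : ∀ {W} → ColorConnecting W → ∀ i →
    + κ (E i) - 1ℤ ≤ + length (avoiding γ i (elements W))
  -- After adding -1 to both sides, `+ suc n - 1ℤ` computes to `+ n`.
  κ-1≤avoiding cc i = ℤ.+-monoˡ-≤ ℤ.-1ℤ (ℤ.+≤+ (κ≤1+avoiding cc i))

  sum[κ-1]≤w*m : ∀ {w} → IsMinimumSize w → sum (λ i → + κ (E i) - 1ℤ) ≤ + w ℤ.* + m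
  sum[κ-1]≤w*m ((W , cc , refl) , _) = begin
    sum (λ i → + κ (E i) - 1ℤ)                          ≤⟨ sum-mono-≤ (κ-1≤avoiding cc) ⟩
    sum (λ i → + length (avoiding γ i (elements W)))    ≡⟨ sum-avoiding γ (elements W) ⟩
    + (length (elements W) ℕ.* m)                       ≡⟨ cong (λ n → + (n ℕ.* m)) (length-elements W) ⟩
    + (∣ W ∣ ℕ.* m)                                     ≡⟨ ℤ.pos-* ∣ W ∣ m ⟩
    + ∣ W ∣ ℤ.* + m                                     ∎
    where open ℤ.≤-Reasoning

proposition5p4 : ∀ {ℓ : ℕ} (G : EdgeColoredGraph ℓ) (2≤ℓ : 2 ≤ℕ ℓ) →
    let open EdgeColoredGraph G in
    ceiling (_/_ (sum (λ i → + (κ (E i)) - 1ℤ)) (ℓ ∸ 1) {{n∸1-nonZero 2≤ℓ}}) ≤ + wld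
-- Writing `ℓ` as `suc m` makes `ℓ ∸ 1` compute to `m`, the factor from the double count.
proposition5p4 {ℕ.suc m} G 2≤ℓ =
  i≤k*n⇒⌈i/n⌉≤k _ m {{n∸1-nonZero 2≤ℓ}} (sum[κ-1]≤w*m G (proj₂ minimumSize))
  where open EdgeColoredGraph G
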